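{- Let $G=(V,E,w)$ be a finite connected graph with $|V|=n\ge2$ and weights $w:E\to\mathbb{R}_{>0}$. For every connected binary hierarchy $T\in\mathcal T_{\mathrm{conn}}^{\mathrm{bin}}(G)$, $$\frac{\operatorname{cost}_D^-(T)}{F(T)}=\sum_{S\in\mathcal I(T)}\mu_T(S)\rho_T(S)=\mathbb E_{\mu_T}[\rho_T].$$ In particular, if $T_\star\in\mathcal T_{\mathrm{conn}}^{\mathrm{bin}}(G)$ is free optimal, i.e. $F(T_\star)=\operatorname{OPT}_{\mathrm{free}}(G,w)$, then $$\frac{\operatorname{OPT}_{\mathrm{card}}(G,w)}{\operatorname{OPT}_{\mathrm{free}}(G,w)}\le\mathbb E_{\mu_{T_\star}}[\rho_{T_\star}].$$
   Context: $d_G$ is the shortest-path metric of $(V,E)$ with every edge of length $1$ (weights are not lengths); $\operatorname{diam}_{d_G}(S)=\max_{a,b\in S}d_G(a,b)$. A rooted binary hierarchy $T$ on $V$ is a rooted tree whose leaves are the vertices of $V$ and whose internal nodes have exactly two children; each node is identified with the set of leaves below it (a cluster); $C_T(x,y)$ is the cluster of the lowest common ancestor of $x,y$. $\mathcal T_{\mathrm{conn}}^{\mathrm{bin}}(G)$ is the set of rooted binary hierarchies all of whose clusters induce connected subgraphs of $G$. $\mathcal I(T)$ is the family of internal (non-leaf) clusters. For $S\in\mathcal I(T)$ with children $S^0,S^1$: $b_T(S)$ is the total weight of edges with one endpoint in $S^0$ and the other in $S^1$; $\Delta_T(S)=\operatorname{diam}_{d_G}(S)$; $a_T(S)=\Delta_T(S)b_T(S)$;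 $\rho_T(S)=(|S|-1)/\Delta_T(S)$. $F(T)=\sum_{xy\in E}w_{xy}\operatorname{diam}_{d_G}(C_T(x,y))>0$, and $\mu_T(S)=a_T(S)/F(T)$, which is a probability measure on $\mathcal I(T)$. $\operatorname{cost}_D^-(T)=\sum_{xy\in E}w_{xy}(|C_T(x,y)|-1)$. $\operatorname{OPT}_{\mathrm{free}}(G,w)$ is the minimum of $\sum_{xy\in E}w_{xy}u(x,y)$ over all ultrametrics $u$ on $V$ (metrics with $u(x,y)\le\max\{u(x,z),u(z,y)\}$) with $u\ge d_G$ on all pairs. Put $h_H(x,x)=0$, $h_H(x,y)=|C_H(x,y)|-1$ for $x\ne y$; $\operatorname{OPT}_{\mathrm{card}}(G,w)$ is the minimum of $\sum_{xy\in E}w_{xy}h_H(x,y)$ over all rooted binary hierarchies $H$ on $V$ with $h_H\ge d_G$ on all pairs. -}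

module Defs where

open import Level using (Level; 0ℓ) renaming (_⊔_ to _⊔ˡ_; suc to lsuc)
open import Algebra.Bundles using (CommutativeRing)
open import Algebra.Core using (Op₁; Op₂)
import Algebra.Construct.NaturalChoice.Max as NaturalMax
import Algebra.Definitions.RawMonoid as RawMonoidDefs
open import Data.Bool.Base using (if_then_else_)
open import Data.Fin.Base using (Fin) renaming (_<_ to _<ᶠ_)
open import Data.Fin.Properties using (any?) renaming (_≟_ to _≟ᶠ_; _<?_ to _<?ᶠ_)
open import Data.Fin.Subset using (Subset; ⁅_⁆; _∪_; _∈_; ∣_∣)
open import Data.Fin.Subset.Properties using (_∈?_)
open import Data.List.Base
  using (List; []; _∷_; _++_; map; filter; foldr; allFin; cartesianProduct; cartesianProductWith)
open import Data.List.Extrema.Nat using (max)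
open import Data.List.Relation.Binary.Permutation.Propositional using (_↭_)
open import Data.List.Relation.Unary.All using (All)
open import Data.Nat.Base using (ℕ; zero; suc; _∸_; z≤n; s≤s) renaming (_≤_ to _≤ⁿ_)
open import Data.Product.Base using (∃; _×_; _,_; proj₁)
open import Data.Sum.Base using (_⊎_)
open import Data.Tree.Binary using (Tree; leaf; node; module Leaves)
open import Data.Unit.Base using (⊤)
open import Function.Base using (_∘_)
open import Function.Metric.Structures using (IsGeneralMetric)
open import Relation.Binary.Bundles using (TotalOrder)
open import Relation.Binary.Core using (Rel)
open import Relation.Binary.Definitions using (Irreflexive; Symmetric)
  renaming (Decidable to Decidable₂)
open import Relation.Binary.PropositionalEquality.Core using (_≡_; refl)
open import Relation.Binary.Structures using (IsTotalOrder)
open import Relation.Nullary.Decidable using (Dec; yes; no; does; map′; _×-dec_; _⊎-dec_)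
open import Relation.Nullary.Negation using (¬_; contradiction)
open import Relation.Unary using (Pred; Decidable)

-- The real numbers, characterised up to isomorphism as a Dedekind-complete
-- ordered field.  Inversion is total, with an unspecified value at 0#.

record Reals (c ℓ₁ ℓ₂ : Level) : Set (lsuc (c ⊔ˡ ℓ₁ ⊔ˡ ℓ₂)) where
  infix  4 _≤_ _<_
  infixl 7 _/_
  infix  9 _⁻¹

  field
    commutativeRing : CommutativeRing c ℓ₁

  open CommutativeRing commutativeRing public

  field
    _≤_          : Rel Carrier ℓ₂
    isTotalOrder : IsTotalOrder _≈_ _≤_
    _⁻¹          : Op₁ Carrier
    ⁻¹-cong      : ∀ {x y} → x ≈ y → x ⁻¹ ≈ y ⁻¹
    *-inverseʳ   : ∀ x → ¬ x ≈ 0# → x * x ⁻¹ ≈ 1#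
    0≉1          : ¬ 0# ≈ 1#
    +-monoˡ-≤    : ∀ z {x y} → x ≤ y → x + z ≤ y + z
    *-nonNeg     : ∀ {x y} → 0# ≤ x → 0# ≤ y → 0# ≤ x * y
    supremum     : (P : Pred Carrier (c ⊔ˡ ℓ₁ ⊔ˡ ℓ₂)) → ∃ P →
                   ∃ (λ b → ∀ x → P x → x ≤ b) →
                   ∃ λ s → (∀ x → P x → x ≤ s) ×
                           (∀ b → (∀ x → P x → x ≤ b) → s ≤ b)

  totalOrder : TotalOrder c ℓ₁ ℓ₂
  totalOrder = record { isTotalOrder = isTotalOrder }

  open NaturalMax totalOrder public using (_⊔_)

  _<_ : Rel Carrier (ℓ₁ ⊔ˡ ℓ₂)
  x < y = x ≤ y × ¬ x ≈ y

  _/_ : Op₂ Carrier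
  x / y = x * y ⁻¹

  fromℕ : ℕ → Carrier
  fromℕ k = k ×ⁿ 1#
    where open RawMonoidDefs +-rawMonoid renaming (_×_ to _×ⁿ_)

  ∑ : ∀ {a} {A : Set a} → List A → (A → Carrier) → Carrier
  ∑ xs f = foldr _+_ 0# (map f xs)

  𝔼 : ∀ {a} {A : Set a} → List A → (A → Carrier) → (A → Carrier) → Carrier
  𝔼 Ω μ X = ∑ Ω (λ ω → μ ω * X ω)

  IsMinimum : ∀ {a p} {A : Set a} → Pred A p → (A → Carrier) → Carrier → Set (a ⊔ˡ p ⊔ˡ ℓ₁ ⊔ˡ ℓ₂)
  IsMinimum Feasible cost m =
    ∃ (λ a → Feasible a × cost a ≈ m) × (∀ a → Feasible a → m ≤ cost a)

data Walk {n : ℕ} (_~_ : Rel (Fin n) 0ℓ) : ℕ → Fin n → Fin n → Set where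
  nil  : ∀ {x} → Walk _~_ 0 x x
  cons : ∀ {k x y z} → x ~ y → Walk _~_ k y z → Walk _~_ (suc k) x z

walk? : ∀ {n} {_~_ : Rel (Fin n) 0ℓ} → Decidable₂ _~_ → ∀ k x y → Dec (Walk _~_ k x y)
walk? _~?_ zero    x y = map′ (λ { refl → nil }) (λ { nil → refl }) (x ≟ᶠ y)
walk? _~?_ (suc k) x y =
  map′ (λ (z , e , p) → cons e p) (λ { (cons e p) → _ , e , p })
       (any? λ z → (x ~? z) ×-dec walk? _~?_ k z y)

least : {P : Pred ℕ 0ℓ} → Decidable P → ∀ k → P k → ∃ λ m → P m × (∀ {j} → P j → m ≤ⁿ j)
least P? k       pk with P? 0
least P? k       pk | yes p0 = 0 , p0 , λ _ → z≤n
least P? zero    pk | no ¬p0 = contradiction pk ¬p0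
least P? (suc k) pk | no ¬p0 with least (P? ∘ suc) k pk
... | m , pm , m≤ = suc m , pm ,
      λ { {zero} p0 → contradiction p0 ¬p0 ; {suc _} pj → s≤s (m≤ pj) }

-- Only the values of weight on adjacent pairs are ever used.

record ConnectedWeightedGraph {c ℓ₁ ℓ₂ : Level} (ℝ : Reals c ℓ₁ ℓ₂) (n : ℕ)
       : Set (lsuc 0ℓ ⊔ˡ c ⊔ˡ ℓ₁ ⊔ˡ ℓ₂) where
  open Reals ℝ using (Carrier; _≈_; _<_; 0#)
  field
    Adj        : Rel (Fin n) 0ℓ
    adj?       : Decidable₂ Adj
    adj-sym    : Symmetric Adj
    adj-irrefl : Irreflexive _≡_ Adj
    connected  : ∀ x y → ∃ λ k → Walk Adj k x y
    weight     : Fin n → Fin n → Carrier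
    weight-sym : ∀ {x y} → Adj x y → weight x y ≈ weight y x
    weight-pos : ∀ {x y} → Adj x y → 0# < weight x y

BinTree : ℕ → Set
BinTree n = Tree ⊤ (Fin n)

cluster : ∀ {n} → BinTree n → Subset n
cluster (leaf x)     = ⁅ x ⁆
cluster (node l _ r) = cluster l ∪ cluster r

clusters : ∀ {n} → BinTree n → List (Subset n)
clusters (leaf x)         = cluster (leaf x) ∷ []
clusters t@(node l _ r)   = cluster t ∷ clusters l ++ clusters r

record Hierarchy (n : ℕ) : Set where
  field
    tree     : BinTree n
    leaves↭V : Leaves.toList tree ↭ allFin n

-- An internal node, given by its two child subtrees.  In a hierarchy distinct
-- internal nodes have distinct clusters, so listing internal nodes is the same
-- as listing internal clusters.

record InternalNode (n : ℕ) : Set where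
  constructor _∣_
  field
    left right : BinTree n

  cluster⁰ cluster¹ clusterᴵ : Subset n
  cluster⁰ = cluster left
  cluster¹ = cluster right
  clusterᴵ = cluster⁰ ∪ cluster¹

internalNodes : ∀ {n} → BinTree n → List (InternalNode n)
internalNodes (leaf x)     = []
internalNodes (node l _ r) = (l ∣ r) ∷ internalNodes l ++ internalNodes r

lcaTree : ∀ {n} → BinTree n → Fin n → Fin n → BinTree n
lcaTree (leaf z) x y = leaf z
lcaTree t@(node l _ r) x y =
  if does (x ∈? cluster l ×-dec y ∈? cluster l) then lcaTree l x y else
  if does (x ∈? cluster r ×-dec y ∈? cluster r) then lcaTree r x y else
  t

module Hierarchies {n : ℕ} where
  open Hierarchy

  𝓘 : Hierarchy n → List (InternalNode n)
  𝓘 T = internalNodes (tree T)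

  C : Hierarchy n → Fin n → Fin n → Subset n
  C T x y = cluster (lcaTree (tree T) x y)

  h : Hierarchy n → Fin n → Fin n → ℕ
  h H x y = if does (x ≟ᶠ y) then 0 else ∣ C H x y ∣ ∸ 1

open Hierarchies public

module GraphQuantities
  {c ℓ₁ ℓ₂ : Level} {ℝ : Reals c ℓ₁ ℓ₂} {n : ℕ} (G : ConnectedWeightedGraph ℝ n) where

  open Reals ℝ
  open ConnectedWeightedGraph G
  open InternalNode using (cluster⁰; cluster¹; clusterᴵ)

  d : Fin n → Fin n → ℕ
  d x y = let (k , p) = connected x y in proj₁ (least (λ j → walk? adj? j x y) k p)

  diam : Subset n → ℕ
  diam S = max 0 (cartesianProductWith d elements elements)
    where elements = filter (_∈? S) (allFin n)

  InducesConnected : Subset n → Set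
  InducesConnected S = ∀ x y → x ∈ S → y ∈ S →
    ∃ λ k → Walk (λ u v → u ∈ S × v ∈ S × Adj u v) k x y

  IsConnected : Hierarchy n → Set
  IsConnected T = All InducesConnected (clusters (Hierarchy.tree T))

  -- Each undirected edge is listed once, as its increasing pair of endpoints.

  edges : List (Fin n × Fin n)
  edges = filter (λ (x , y) → (x <?ᶠ y) ×-dec adj? x y) (cartesianProduct (allFin n) (allFin n))

  weightedSum : (Fin n → Fin n → Carrier) → Carrier
  weightedSum f = ∑ edges (λ (x , y) → weight x y * f x y)

  b : InternalNode n → Carrier
  b S = ∑ (filter crosses? edges) (λ (x , y) → weight x y)
    where
    crosses? : Decidable (λ (x , y) → (x ∈ cluster⁰ S × y ∈ cluster¹ S)
                                    ⊎ (x ∈ cluster¹ S × y ∈ cluster⁰ S))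
    crosses? (x , y) = (x ∈? cluster⁰ S ×-dec y ∈? cluster¹ S)
                 ⊎-dec (x ∈? cluster¹ S ×-dec y ∈? cluster⁰ S)

  Δ : InternalNode n → ℕ
  Δ S = diam (clusterᴵ S)

  a : InternalNode n → Carrier
  a S = fromℕ (Δ S) * b S

  ρ : InternalNode n → Carrier
  ρ S = fromℕ (∣ clusterᴵ S ∣ ∸ 1) / fromℕ (Δ S)

  F : Hierarchy n → Carrier
  F T = weightedSum (λ x y → fromℕ (diam (C T x y)))

  μ : Hierarchy n → InternalNode n → Carrier
  μ T S = a S / F T

  cost⁻ : Hierarchy n → Carrier
  cost⁻ T = weightedSum (λ x y → fromℕ (∣ C T x y ∣ ∸ 1))

  -- The strong triangle inequality together with nonnegativity gives the usual
  -- one, so these are metrics.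

  IsUltrametric : (Fin n → Fin n → Carrier) → Set (c ⊔ˡ ℓ₁ ⊔ˡ ℓ₂)
  IsUltrametric = IsGeneralMetric _≡_ _≈_ _≤_ 0# _⊔_

  IsOPTfree : Carrier → Set (c ⊔ˡ ℓ₁ ⊔ˡ ℓ₂)
  IsOPTfree = IsMinimum (λ u → IsUltrametric u × (∀ x y → fromℕ (d x y) ≤ u x y)) weightedSum

  IsOPTcard : Carrier → Set (ℓ₁ ⊔ˡ ℓ₂)
  IsOPTcard = IsMinimum (λ H → ∀ x y → d x y ≤ⁿ h H x y)
                        (λ H → weightedSum (λ x y → fromℕ (h H x y)))

{-# OPTIONS --safe #-}
module Submission where

-- The endpoints of an edge xy of G are separated by exactly one internal node
-- of T, namely their lowest common ancestor, so for any function g of clusters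
--
--   g (C T x y)  =  sum over the internal nodes S separating x and y of g S.
--
-- Multiplying by the weight of xy, summing over the edges and exchanging the
-- two sums gives (weightedSum-C)
--
--   sum over edges xy of w xy * g (C T x y)  =  sum over S of b S * g S.
--
-- For g S = |S| - 1 the left side is cost⁻ T.  On the right, an internal
-- cluster S contains two distinct vertices, hence has positive diameter, so
-- b S * (|S| - 1) = (Δ S * b S) * ((|S| - 1) / Δ S) = a S * ρ S.  Dividing by
-- F T gives the identity (cost⁻/F≈𝔼ρ).
--
-- For the inequality, two vertices of a connected set S are joined by a path
-- inside S, which has at most |S| - 1 edges (shortWalk).  Applied to the
-- clusters C T⋆ x y this says that h T⋆ dominates d, so T⋆ competes in the
-- minimum defining OPTcard and OPTcard is at most cost⁻ T⋆ (OPTcard≤cost⁻).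
-- Division by OPTfree = F T⋆ preserves this bound because F T⋆ is positive
-- (F-pos): with two vertices and connectedness there is at least one edge.

open import Defs
open import Data.Nat.Base using (ℕ) renaming (_≤_ to _≤ⁿ_)
open import Data.Product.Base using (_×_)

open import Level using (Level; 0ℓ)
open import Algebra.Properties.CommutativeSemigroup as CommutativeSemigroupProperties using ()
open import Algebra.Properties.Ring as RingProperties using ()
open import Data.Bool.Base using (if_then_else_; true; false)
open import Data.Fin.Base using (Fin; zero; suc) renaming (_<_ to _<ᶠ_)
open import Data.Fin.Properties using (<-cmp) renaming (_≟_ to _≟ᶠ_; _<?_ to _<?ᶠ_)
open import Data.Fin.Subset as Subset using (Subset; _∈_; _∉_; ∣_∣; ⁅_⁆)
open import Data.Fin.Subset.Properties
  using (_∈?_; x∈p∪q⁻; x∈p∪q⁺; x∈⁅x⁆; x∈⁅y⁆⇒x≡y; x∈p∧x≢y⇒x∈p-y; x∈p⇒∣p-x∣<∣p∣; p─q─q≡p─q)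
open import Data.List.Base using (List; []; _∷_; _++_; filter; allFin; cartesianProduct)
open import Data.List.Extrema.Nat using (xs≤max)
open import Data.List.Membership.Propositional using () renaming (_∈_ to _∈ˡ_)
open import Data.List.Membership.Propositional.Properties
  using (∈-filter⁺; ∈-filter⁻; ∈-cartesianProduct⁺; ∈-cartesianProductWith⁺; ∈-allFin; ∈-++⁺ˡ; ∈-++⁺ʳ; ∈-++⁻)
open import Data.List.Properties using (++-assoc)
open import Data.List.Relation.Binary.Permutation.Propositional using (↭-sym; ↭⇒↭ₛ)
open import Data.List.Relation.Binary.Permutation.Propositional.Properties using (∈-resp-↭)
open import Data.List.Relation.Binary.Permutation.Setoid.Properties using (Unique-resp-↭)
open import Data.List.Relation.Unary.All as All using (All; []; _∷_)
import Data.List.Relation.Unary.All.Properties as All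
open import Data.List.Relation.Unary.AllPairs using ([]; _∷_)
open import Data.List.Relation.Unary.Any using (here; there)
open import Data.List.Relation.Unary.Unique.Propositional using (Unique)
open import Data.List.Relation.Unary.Unique.Propositional.Properties using (allFin⁺)
open import Data.Nat.Base using (zero; suc; _∸_; z≤n; s≤s; s≤s⁻¹)
import Data.Nat.Properties as ℕ
open import Data.Product.Base using (∃; _,_; proj₁; proj₂; uncurry)
open import Data.Sum.Base using (_⊎_; inj₁; inj₂; [_,_]′)
open import Data.Tree.Binary using (leaf; node; module Leaves)
open import Function.Base using (_∘_)
open import Relation.Binary.Bundles using (TotalOrder)
open import Relation.Binary.Core using (Rel)
open import Relation.Binary.Definitions using (tri<; tri≈; tri>)
open import Relation.Binary.PropositionalEquality as ≡ using (_≡_; _≢_)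
import Relation.Binary.Reasoning.PartialOrder as PartialOrderReasoning
import Relation.Binary.Reasoning.Setoid as SetoidReasoning
open import Relation.Nullary.Decidable using (Dec; yes; no; does; _×-dec_; _⊎-dec_)
open import Relation.Nullary.Negation using (¬_; contradiction)
open import Relation.Unary using (Decidable)

private
  variable
    α p q : Level
    A B : Set α
    n : ℕ

-- Carries the case distinctions of lcaTree and h without abstracting over
-- conjunctions of decisions, which unfold to conjunctions of Booleans.
if-elim : {P : Set p} (Q : A → Set q) (P? : Dec P) {u v : A} →
          (P → Q u) → (¬ P → Q v) → Q (if does P? then u else v)
if-elim Q (yes p) f g = f p
if-elim Q (no ¬p) f g = g ¬p

-- Walks inside a vertex set

Inside : Rel (Fin n) 0ℓ → Subset n → Rel (Fin n) 0ℓ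
Inside _~_ S u v = u ∈ S × v ∈ S × u ~ v

-- Otherwise removing x a second time would make the set strictly smaller.
x∉p-x : (S : Subset n) (x : Fin n) → x ∉ S Subset.- x
x∉p-x S x x∈ = ℕ.<-irrefl (≡.cong ∣_∣ (p─q─q≡p─q S ⁅ x ⁆)) (x∈p⇒∣p-x∣<∣p∣ x∈)

-- Cutting a walk at its last visit to x leaves a walk that avoids x; the
-- first alternative is a walk that never visits x.
lastExit : {_~_ : Rel (Fin n) 0ℓ} {S : Subset n} {k : ℕ} {u y : Fin n} (x : Fin n) →
           y ∈ S Subset.- x → Walk (Inside _~_ S) k u y →
           (u ∈ S Subset.- x × ∃ λ j → Walk (Inside _~_ (S Subset.- x)) j u y) ⊎
           (∃ λ z → x ~ z × z ∈ S Subset.- x × ∃ λ j → Walk (Inside _~_ (S Subset.- x)) j z y)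
lastExit x y∈ nil = inj₁ (y∈ , _ , nil)
lastExit {u = u} x y∈ (cons (u∈ , _ , e) w) with lastExit x y∈ w
... | inj₂ exit = inj₂ exit
... | inj₁ (v∈ , _ , w′) with u ≟ᶠ x
...   | yes ≡.refl = inj₂ (_ , e , v∈ , _ , w′)
...   | no  u≢x    = inj₁ (u∈′ , _ , cons (u∈′ , v∈ , e) w′)
  where u∈′ = x∈p∧x≢y⇒x∈p-y u∈ u≢x

-- Induction on the size of S: the part of the walk after its last visit to x
-- stays in S without x, so it can be replaced by a walk of length at most
-- m - 1.  This erases loops without ever forming the list of visited vertices.
shortWalk : {_~_ : Rel (Fin n) 0ℓ} (m : ℕ) (S : Subset n) → ∣ S ∣ ≤ⁿ suc m →
            ∀ {k x y} → x ∈ S → y ∈ S → Walk (Inside _~_ S) k x y →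
            ∃ λ j → j ≤ⁿ m × Walk _~_ j x y
shortWalk m S ∣S∣≤ {x = x} {y} x∈ y∈ w with y ≟ᶠ x
... | yes ≡.refl = 0 , z≤n , nil
... | no  y≢x with lastExit x (x∈p∧x≢y⇒x∈p-y y∈ y≢x) w
...   | inj₁ (x∈S-x , _) = contradiction x∈S-x (x∉p-x S x)
...   | inj₂ (z , e , z∈ , _ , w′) = step m (s≤s⁻¹ (ℕ.≤-trans (x∈p⇒∣p-x∣<∣p∣ x∈) ∣S∣≤))
  where
  step : ∀ m → ∣ S Subset.- x ∣ ≤ⁿ m → ∃ λ j → j ≤ⁿ m × Walk _ j x y
  step zero    ≤m = contradiction (ℕ.≤-trans (x∈p⇒∣p-x∣<∣p∣ z∈) ≤m) λ ()
  step (suc m) ≤m =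
    let j , j≤ , w″ = shortWalk m (S Subset.- x) ≤m z∈ (x∈p∧x≢y⇒x∈p-y y∈ y≢x) w′
    in  suc j , s≤s j≤ , cons e w″

connected⇒related : {_~_ : Rel (Fin n) 0ℓ} → 2 ≤ⁿ n →
                    (∀ x y → ∃ λ k → Walk _~_ k x y) → ∃ λ x → ∃ λ y → x ~ y
connected⇒related (s≤s (s≤s z≤n)) conn with conn zero (suc zero)
... | _ , cons xy _ = _ , _ , xy

-- Trees with distinct leaves

Unique-++⁻ : (xs {ys} : List A) → Unique (xs ++ ys) →
             Unique xs × Unique ys × (∀ {x} → x ∈ˡ xs → ¬ x ∈ˡ ys)
Unique-++⁻ []       u        = [] , u , λ ()
Unique-++⁻ (x ∷ xs) (x∉ ∷ u) =
  let uˡ , uʳ , disj = Unique-++⁻ xs u in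
  All.++⁻ˡ xs x∉ ∷ uˡ , uʳ ,
  λ { (here ≡.refl) x∈ys → All.lookup (All.++⁻ʳ xs x∉) x∈ys ≡.refl
    ; (there x∈xs)  x∈ys → disj x∈xs x∈ys }

toList-node : (l r : BinTree n) → Leaves.toList (node l _ r) ≡ Leaves.toList l ++ Leaves.toList r
toList-node l r = toDiffList-++ l (Leaves.toList r)
  where
  toDiffList-++ : (t : BinTree n) (xs : List (Fin n)) → Leaves.toDiffList t xs ≡ Leaves.toList t ++ xs
  toDiffList-++ (leaf _)     xs = ≡.refl
  toDiffList-++ (node l _ r) xs
    rewrite toDiffList-++ l (Leaves.toDiffList r xs)
          | toDiffList-++ r xs
          | toDiffList-++ l (Leaves.toList r) = ≡.sym (++-assoc (Leaves.toList l) _ _)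

∈-leaves⁺ : (t : BinTree n) {x : Fin n} → x ∈ cluster t → x ∈ˡ Leaves.toList t
∈-leaves⁺ (leaf z)     x∈ = here (x∈⁅y⁆⇒x≡y z x∈)
∈-leaves⁺ (node l _ r) {x} x∈ = ≡.subst (x ∈ˡ_) (≡.sym (toList-node l r))
  ([ ∈-++⁺ˡ ∘ ∈-leaves⁺ l , ∈-++⁺ʳ _ ∘ ∈-leaves⁺ r ]′ (x∈p∪q⁻ _ _ x∈))

∈-leaves⁻ : (t : BinTree n) {x : Fin n} → x ∈ˡ Leaves.toList t → x ∈ cluster t
∈-leaves⁻ (leaf z)     (here ≡.refl) = x∈⁅x⁆ z
∈-leaves⁻ (node l _ r) {x} x∈
  with ∈-++⁻ (Leaves.toList l) (≡.subst (x ∈ˡ_) (toList-node l r) x∈)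
... | inj₁ x∈l = x∈p∪q⁺ (inj₁ (∈-leaves⁻ l x∈l))
... | inj₂ x∈r = x∈p∪q⁺ (inj₂ (∈-leaves⁻ r x∈r))

cluster-nonempty : (t : BinTree n) → ∃ λ x → x ∈ cluster t
cluster-nonempty (leaf z)     = z , x∈⁅x⁆ z
cluster-nonempty (node l _ r) = let x , x∈ = cluster-nonempty l in x , x∈p∪q⁺ (inj₁ x∈)

-- The form in which distinctness of the leaves enters: at most one child of a
-- node contains a given vertex.
DisjointChildren : InternalNode n → Set
DisjointChildren S = ∀ {x} → x ∈ InternalNode.cluster⁰ S → x ∉ InternalNode.cluster¹ S

unique⇒disjoint : (t : BinTree n) → Unique (Leaves.toList t) →
                  All DisjointChildren (internalNodes t)
unique⇒disjoint (leaf _)     _ = []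
unique⇒disjoint (node l _ r) u =
  let uˡ , uʳ , disj = Unique-++⁻ (Leaves.toList l) (≡.subst Unique (toList-node l r) u) in
  (λ x∈l x∈r → disj (∈-leaves⁺ l x∈l) (∈-leaves⁺ r x∈r)) ∷
  All.++⁺ (unique⇒disjoint l uˡ) (unique⇒disjoint r uʳ)

module _ (T : Hierarchy n) where
  open Hierarchy T

  disjointChildren : All DisjointChildren (𝓘 T)
  disjointChildren = unique⇒disjoint tree
    (Unique-resp-↭ (≡.setoid (Fin n)) (↭⇒↭ₛ (↭-sym leaves↭V)) (allFin⁺ n))

  ∈-root : (x : Fin n) → x ∈ cluster tree
  ∈-root x = ∈-leaves⁻ tree (∈-resp-↭ (↭-sym leaves↭V) (∈-allFin x))

lca∈clusters : (t : BinTree n) (x y : Fin n) → cluster (lcaTree t x y) ∈ˡ clusters t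
lca∈clusters (leaf _)       x y = here ≡.refl
lca∈clusters t@(node l _ r) x y =
  if-elim Q (x ∈? cluster l ×-dec y ∈? cluster l)
    (λ _ → there (∈-++⁺ˡ (lca∈clusters l x y))) λ _ →
  if-elim Q (x ∈? cluster r ×-dec y ∈? cluster r)
    (λ _ → there (∈-++⁺ʳ (clusters l) (lca∈clusters r x y))) λ _ →
  here ≡.refl
  where Q = λ s → cluster s ∈ˡ clusters t

∈-lca : (t : BinTree n) {x y : Fin n} → x ∈ cluster t → y ∈ cluster t →
        x ∈ cluster (lcaTree t x y) × y ∈ cluster (lcaTree t x y)
∈-lca (leaf _)             x∈ y∈ = x∈ , y∈
∈-lca t@(node l _ r) {x} {y} x∈ y∈ =
  if-elim Q (x ∈? cluster l ×-dec y ∈? cluster l) (uncurry (∈-lca l)) λ _ →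
  if-elim Q (x ∈? cluster r ×-dec y ∈? cluster r) (uncurry (∈-lca r)) λ _ →
  x∈ , y∈
  where Q = λ s → x ∈ cluster s × y ∈ cluster s

Separates : InternalNode n → Fin n × Fin n → Set
Separates S (x , y) = (x ∈ cluster⁰ S × y ∈ cluster¹ S) ⊎ (x ∈ cluster¹ S × y ∈ cluster⁰ S)
  where open InternalNode

separates? : (S : InternalNode n) → Decidable (Separates S)
separates? S (x , y) = (x ∈? cluster⁰ S ×-dec y ∈? cluster¹ S)
                 ⊎-dec (x ∈? cluster¹ S ×-dec y ∈? cluster⁰ S)
  where open InternalNode

separates⇒∈ : (S : InternalNode n) {x y : Fin n} → Separates S (x , y) →
              x ∈ InternalNode.clusterᴵ S × y ∈ InternalNode.clusterᴵ S
separates⇒∈ S (inj₁ (x∈ , y∈)) = x∈p∪q⁺ (inj₁ x∈) , x∈p∪q⁺ (inj₂ y∈)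
separates⇒∈ S (inj₂ (x∈ , y∈)) = x∈p∪q⁺ (inj₂ x∈) , x∈p∪q⁺ (inj₁ y∈)

-- Ordered fields

module OrderedField {c ℓ₁ ℓ₂} (ℝ : Reals c ℓ₁ ℓ₂) where
  open Reals ℝ
  open RingProperties ring using (-1*x≈-x; -‿involutive; -‿distribʳ-*)
  open CommutativeSemigroupProperties *-commutativeSemigroup using (x∙yz≈y∙xz)
  open TotalOrder totalOrder public using (total; antisym; poset)
    renaming (refl to ≤-refl; trans to ≤-trans; reflexive to ≤-reflexive)
  open PartialOrderReasoning poset

  +-mono-≤ : ∀ {x y u v} → x ≤ y → u ≤ v → x + u ≤ y + v
  +-mono-≤ {x} {y} {u} {v} x≤y u≤v = begin
    x + u ≤⟨ +-monoˡ-≤ u x≤y ⟩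
    y + u ≈⟨ +-comm y u ⟩
    u + y ≤⟨ +-monoˡ-≤ y u≤v ⟩
    v + y ≈⟨ +-comm v y ⟩
    y + v ∎

  x≤y⇒0≤y-x : ∀ {x y} → x ≤ y → 0# ≤ y - x
  x≤y⇒0≤y-x {x} {y} x≤y = begin
    0#    ≈⟨ -‿inverseʳ x ⟨
    x - x ≤⟨ +-monoˡ-≤ (- x) x≤y ⟩
    y - x ∎

  x≤0⇒0≤-x : ∀ {x} → x ≤ 0# → 0# ≤ - x
  x≤0⇒0≤-x x≤0 = ≤-trans (x≤y⇒0≤y-x x≤0) (≤-reflexive (+-identityˡ _))

  *-monoˡ-≤ : ∀ {x y z} → 0# ≤ z → x ≤ y → x * z ≤ y * z
  *-monoˡ-≤ {x} {y} {z} 0≤z x≤y = begin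
    x * z                 ≈⟨ +-identityˡ _ ⟨
    0# + x * z            ≤⟨ +-monoˡ-≤ _ (*-nonNeg (x≤y⇒0≤y-x x≤y) 0≤z) ⟩
    (y - x) * z + x * z   ≈⟨ distribʳ z _ _ ⟨
    (y - x + x) * z       ≈⟨ *-congʳ (+-assoc _ _ _) ⟩
    (y + (- x + x)) * z   ≈⟨ *-congʳ (+-congˡ (-‿inverseˡ x)) ⟩
    (y + 0#) * z          ≈⟨ *-congʳ (+-identityʳ y) ⟩
    y * z                 ∎

  -- If 1# ≤ 0#, then - 1# is nonnegative, and so is its square 1#.
  0≤1 : 0# ≤ 1#
  0≤1 with total 0# 1#
  ... | inj₁ 0≤1 = 0≤1
  ... | inj₂ 1≤0 = begin
    0#            ≤⟨ *-nonNeg (x≤0⇒0≤-x 1≤0) (x≤0⇒0≤-x 1≤0) ⟩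
    - 1# * - 1#   ≈⟨ -1*x≈-x (- 1#) ⟩
    - (- 1#)      ≈⟨ -‿involutive 1# ⟩
    1#            ∎

  0≤fromℕ : ∀ k → 0# ≤ fromℕ k
  0≤fromℕ zero    = ≤-refl
  0≤fromℕ (suc k) = ≤-trans (≤-reflexive (sym (+-identityˡ 0#))) (+-mono-≤ 0≤1 (0≤fromℕ k))

  1≤fromℕ : ∀ {k} → 1 ≤ⁿ k → 1# ≤ fromℕ k
  1≤fromℕ {suc k} _ = ≤-trans (≤-reflexive (sym (+-identityʳ 1#))) (+-mono-≤ ≤-refl (0≤fromℕ k))

  1≤x⇒x≉0 : ∀ {x} → 1# ≤ x → ¬ x ≈ 0#
  1≤x⇒x≉0 1≤x x≈0 = 0≉1 (antisym 0≤1 (≤-trans 1≤x (≤-reflexive x≈0)))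

  -- If x ⁻¹ were nonpositive, then - (x * x ⁻¹) = - 1# would be nonnegative.
  0<x⇒0≤x⁻¹ : ∀ {x} → 0# < x → 0# ≤ x ⁻¹
  0<x⇒0≤x⁻¹ {x} (0≤x , 0≉x) with total 0# (x ⁻¹)
  ... | inj₁ 0≤x⁻¹ = 0≤x⁻¹
  ... | inj₂ x⁻¹≤0 = contradiction (antisym 0≤1 1≤0) 0≉1
    where
    1≤0 : 1# ≤ 0#
    1≤0 = begin
      1#                       ≈⟨ +-identityˡ 1# ⟨
      0# + 1#                  ≤⟨ +-monoˡ-≤ 1# (*-nonNeg 0≤x (x≤0⇒0≤-x x⁻¹≤0)) ⟩
      x * - (x ⁻¹) + 1#        ≈⟨ +-congʳ (-‿distribʳ-* x (x ⁻¹)) ⟨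
      - (x * x ⁻¹) + 1#        ≈⟨ +-congˡ (*-inverseʳ x (0≉x ∘ sym)) ⟨
      - (x * x ⁻¹) + x * x ⁻¹  ≈⟨ -‿inverseˡ _ ⟩
      0#                       ∎

  *-cancel-inverse : ∀ {x} y → ¬ x ≈ 0# → x * (y * x ⁻¹) ≈ y
  *-cancel-inverse {x} y x≉0 = begin-equality
    x * (y * x ⁻¹) ≈⟨ x∙yz≈y∙xz x y (x ⁻¹) ⟩
    y * (x * x ⁻¹) ≈⟨ *-congˡ (*-inverseʳ x x≉0) ⟩
    y * 1#         ≈⟨ *-identityʳ y ⟩
    y              ∎

-- Finite sums

module Sums {c ℓ₁ ℓ₂} (ℝ : Reals c ℓ₁ ℓ₂) where
  open Reals ℝ
  open OrderedField ℝ
  open CommutativeSemigroupProperties +-commutativeSemigroup using (interchange)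

  ∑-cong : (xs : List A) {f g : A → Carrier} → (∀ {x} → x ∈ˡ xs → f x ≈ g x) → ∑ xs f ≈ ∑ xs g
  ∑-cong []       f≈g = refl
  ∑-cong (x ∷ xs) f≈g = +-cong (f≈g (here ≡.refl)) (∑-cong xs (f≈g ∘ there))

  ∑-++ : (xs {ys} : List A) (f : A → Carrier) → ∑ (xs ++ ys) f ≈ ∑ xs f + ∑ ys f
  ∑-++ []       f = sym (+-identityˡ _)
  ∑-++ (x ∷ xs) f = trans (+-congˡ (∑-++ xs f)) (sym (+-assoc _ _ _))

  ∑-zero : (xs : List A) {f : A → Carrier} → (∀ {x} → x ∈ˡ xs → f x ≈ 0#) → ∑ xs f ≈ 0#
  ∑-zero []       f≈0 = refl
  ∑-zero (x ∷ xs) f≈0 =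
    trans (+-cong (f≈0 (here ≡.refl)) (∑-zero xs (f≈0 ∘ there))) (+-identityˡ 0#)

  ∑-distrib-+ : (xs : List A) (f g : A → Carrier) → ∑ xs (λ x → f x + g x) ≈ ∑ xs f + ∑ xs g
  ∑-distrib-+ []       f g = sym (+-identityˡ 0#)
  ∑-distrib-+ (x ∷ xs) f g = trans (+-congˡ (∑-distrib-+ xs f g)) (interchange _ _ _ _)

  *-distribˡ-∑ : (xs : List A) (f : A → Carrier) (z : Carrier) → z * ∑ xs f ≈ ∑ xs (λ x → z * f x)
  *-distribˡ-∑ []       f z = zeroʳ z
  *-distribˡ-∑ (x ∷ xs) f z = trans (distribˡ _ _ _) (+-congˡ (*-distribˡ-∑ xs f z))

  *-distribʳ-∑ : (xs : List A) (f : A → Carrier) (z : Carrier) → ∑ xs f * z ≈ ∑ xs (λ x → f x * z)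
  *-distribʳ-∑ []       f z = zeroˡ z
  *-distribʳ-∑ (x ∷ xs) f z = trans (distribʳ _ _ _) (+-congˡ (*-distribʳ-∑ xs f z))

  ∑-swap : (xs : List A) (ys : List B) (f : A → B → Carrier) →
           ∑ xs (λ x → ∑ ys (f x)) ≈ ∑ ys (λ y → ∑ xs (λ x → f x y))
  ∑-swap []       ys f = sym (∑-zero ys λ _ → refl)
  ∑-swap (x ∷ xs) ys f = trans (+-congˡ (∑-swap xs ys f)) (sym (∑-distrib-+ ys _ _))

  -- The Iverson bracket of P, times z.
  [_]·_ : {P : Set p} → Dec P → Carrier → Carrier
  [ P? ]· z = if does P? then z else 0#

  []·-true : {P : Set p} (P? : Dec P) {z : Carrier} → P → [ P? ]· z ≈ z
  []·-true P? {z} p = if-elim (_≈ z) P? (λ _ → refl) (contradiction p)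

  []·-false : {P : Set p} (P? : Dec P) {z : Carrier} → ¬ P → [ P? ]· z ≈ 0#
  []·-false P? ¬p = if-elim (_≈ 0#) P? (λ p → contradiction p ¬p) (λ _ → refl)

  *-[]· : {P : Set p} (P? : Dec P) (y z : Carrier) → y * ([ P? ]· z) ≈ [ P? ]· (y * z)
  *-[]· P? y z with does P?
  ... | true  = refl
  ... | false = zeroʳ y

  ∑-filter : {P : A → Set p} (P? : Decidable P) (xs : List A) (f : A → Carrier) →
             ∑ (filter P? xs) f ≈ ∑ xs (λ x → [ P? x ]· f x)
  ∑-filter P? []       f = refl
  ∑-filter P? (x ∷ xs) f with does (P? x)
  ... | true  = +-congˡ (∑-filter P? xs f)
  ... | false = trans (∑-filter P? xs f) (sym (+-identityˡ _))

  0≤∑ : (xs : List A) {f : A → Carrier} → (∀ {x} → x ∈ˡ xs → 0# ≤ f x) → 0# ≤ ∑ xs f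
  0≤∑ []       0≤f = ≤-refl
  0≤∑ (x ∷ xs) 0≤f = ≤-trans (≤-reflexive (sym (+-identityˡ 0#)))
    (+-mono-≤ (0≤f (here ≡.refl)) (0≤∑ xs (0≤f ∘ there)))

  term≤∑ : {xs : List A} {f : A → Carrier} {x : A} →
           (∀ {x} → x ∈ˡ xs → 0# ≤ f x) → x ∈ˡ xs → f x ≤ ∑ xs f
  term≤∑ 0≤f (here ≡.refl) = ≤-trans (≤-reflexive (sym (+-identityʳ _)))
    (+-mono-≤ ≤-refl (0≤∑ _ (0≤f ∘ there)))
  term≤∑ 0≤f (there x∈) = ≤-trans (≤-reflexive (sym (+-identityˡ _)))
    (+-mono-≤ (0≤f (here ≡.refl)) (term≤∑ (0≤f ∘ there) x∈))

  -- Summing over internal nodes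

  module _ (g : Subset n → Carrier) where
    open InternalNode using (clusterᴵ)

    separatingSum : BinTree n → Fin n → Fin n → Carrier
    separatingSum t x y = ∑ (internalNodes t) λ S → [ separates? S (x , y) ]· g (clusterᴵ S)

    -- A node separating x and y has both of them in its cluster, so a tree that
    -- lacks one of them has no such node.
    separatingSum-outside : ∀ t x y → ¬ (x ∈ cluster t × y ∈ cluster t) →
                            separatingSum t x y ≈ 0#
    separatingSum-outside (leaf _)     x y _  = refl
    separatingSum-outside (node l _ r) x y ∉ = begin
      [ separates? (l ∣ r) (x , y) ]· _ + _
        ≈⟨ +-cong ([]·-false (separates? (l ∣ r) (x , y)) (∉ ∘ separates⇒∈ (l ∣ r)))
                  (∑-++ (internalNodes l) _) ⟩
      0# + (separatingSum l x y + separatingSum r x y)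
        ≈⟨ +-identityˡ _ ⟩
      separatingSum l x y + separatingSum r x y
        ≈⟨ +-cong (separatingSum-outside l x y λ (x∈ , y∈) → ∉ (x∈p∪q⁺ (inj₁ x∈) , x∈p∪q⁺ (inj₁ y∈)))
                  (separatingSum-outside r x y λ (x∈ , y∈) → ∉ (x∈p∪q⁺ (inj₂ x∈) , x∈p∪q⁺ (inj₂ y∈))) ⟩
      0# + 0#
        ≈⟨ +-identityˡ 0# ⟩
      0# ∎
      where open SetoidReasoning setoid

    -- Of the root, the left and the right subtree, exactly one contributes: the
    -- subtree containing both vertices if there is one, and otherwise the root.
    -- This is the case distinction by which lcaTree descends.
    separatingSum-lca : ∀ t {x y} → All DisjointChildren (internalNodes t) → x ≢ y →
                        x ∈ cluster t → y ∈ cluster t →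
                        separatingSum t x y ≈ g (cluster (lcaTree t x y))
    separatingSum-lca (leaf z) _ x≢y x∈ y∈ =
      contradiction (≡.trans (x∈⁅y⁆⇒x≡y z x∈) (≡.sym (x∈⁅y⁆⇒x≡y z y∈))) x≢y
    separatingSum-lca t@(node l _ r) {x} {y} (disj ∷ disjs) x≢y x∈ y∈ =
      trans (+-congˡ (∑-++ (internalNodes l) _)) (
      if-elim Q (x ∈? cluster l ×-dec y ∈? cluster l)
        (λ (x∈l , y∈l) → trans
          (+-cong ([]·-false sep? {root} λ { (inj₁ (_ , y∈r)) → disj y∈l y∈r
                                    ; (inj₂ (x∈r , _)) → disj x∈l x∈r })
            (+-cong (separatingSum-lca l disjˡ x≢y x∈l y∈l)
                    (separatingSum-outside r x y λ (x∈r , _) → disj x∈l x∈r)))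
          (trans (+-identityˡ _) (+-identityʳ _))) λ ¬l →
      if-elim Q (x ∈? cluster r ×-dec y ∈? cluster r)
        (λ (x∈r , y∈r) → trans
          (+-cong ([]·-false sep? {root} λ { (inj₁ (x∈l , _)) → disj x∈l x∈r
                                    ; (inj₂ (_ , y∈l)) → disj y∈l y∈r })
            (+-cong (separatingSum-outside l x y λ (x∈l , _) → disj x∈l x∈r)
                    (separatingSum-lca r disjʳ x≢y x∈r y∈r)))
          (trans (+-identityˡ _) (+-identityˡ _))) λ ¬r →
      trans
        (+-cong ([]·-true sep? {root} (split (x∈p∪q⁻ _ _ x∈) (x∈p∪q⁻ _ _ y∈) ¬l ¬r))
          (+-cong (separatingSum-outside l x y ¬l) (separatingSum-outside r x y ¬r)))
        (trans (+-congˡ (+-identityˡ 0#)) (+-identityʳ _)))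
      where
      root  = g (cluster t)
      sep?  = separates? (l ∣ r) (x , y)
      disjˡ = All.++⁻ˡ (internalNodes l) disjs
      disjʳ = All.++⁻ʳ (internalNodes l) disjs

      Q = λ s → [ sep? ]· root + (separatingSum l x y + separatingSum r x y)
                ≈ g (cluster s)

      split : x ∈ cluster l ⊎ x ∈ cluster r → y ∈ cluster l ⊎ y ∈ cluster r →
              ¬ (x ∈ cluster l × y ∈ cluster l) → ¬ (x ∈ cluster r × y ∈ cluster r) →
              Separates (l ∣ r) (x , y)
      split (inj₁ x∈l) (inj₁ y∈l) ¬l ¬r = contradiction (x∈l , y∈l) ¬l
      split (inj₁ x∈l) (inj₂ y∈r) ¬l ¬r = inj₁ (x∈l , y∈r)
      split (inj₂ x∈r) (inj₁ y∈l) ¬l ¬r = inj₂ (x∈r , y∈l)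
      split (inj₂ x∈r) (inj₂ y∈r) ¬l ¬r = contradiction (x∈r , y∈r) ¬r

-- Distances, cuts and costs in the graph

module Graph {c ℓ₁ ℓ₂} {ℝ : Reals c ℓ₁ ℓ₂} (G : ConnectedWeightedGraph ℝ n) where
  open Reals ℝ
  open ConnectedWeightedGraph G
  open GraphQuantities G
  open OrderedField ℝ
  open Sums ℝ
  open InternalNode using (clusterᴵ)

  d≤walk : ∀ {k x y} → Walk Adj k x y → d x y ≤ⁿ k
  d≤walk {x = x} {y} w = let k , v = connected x y in
    proj₂ (proj₂ (least (λ j → walk? adj? j x y) k v)) w

  geodesic : ∀ x y → Walk Adj (d x y) x y
  geodesic x y = let k , v = connected x y in
    proj₁ (proj₂ (least (λ j → walk? adj? j x y) k v))

  x≢y⇒1≤d : ∀ {x y} → x ≢ y → 1 ≤ⁿ d x y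
  x≢y⇒1≤d {x} {y} x≢y with d x y | geodesic x y
  ... | zero  | nil = contradiction ≡.refl x≢y
  ... | suc _ | _   = s≤s z≤n

  d≤diam : ∀ {S x y} → x ∈ S → y ∈ S → d x y ≤ⁿ diam S
  d≤diam {S} {x} {y} x∈ y∈ = All.lookup (xs≤max 0 _)
    (∈-cartesianProductWith⁺ d (∈-filter⁺ (_∈? S) (∈-allFin x) x∈) (∈-filter⁺ (_∈? S) (∈-allFin y) y∈))

  -- Makes Δ S invertible in ρ S and F T positive.
  1≤diam : ∀ {S x y} → x ∈ S → y ∈ S → x ≢ y → 1 ≤ⁿ diam S
  1≤diam x∈ y∈ x≢y = ℕ.≤-trans (x≢y⇒1≤d x≢y) (d≤diam x∈ y∈)

  d≤∣S∣∸1 : ∀ {S} → InducesConnected S → ∀ {x y} → x ∈ S → y ∈ S → d x y ≤ⁿ ∣ S ∣ ∸ 1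
  d≤∣S∣∸1 {S} conn {x} {y} x∈ y∈ =
    let _ , w      = conn x y x∈ y∈
        _ , j≤ , v = shortWalk (∣ S ∣ ∸ 1) S (ℕ.m≤n+m∸n ∣ S ∣ 1) x∈ y∈ w
    in  ℕ.≤-trans (d≤walk v) j≤

  IncreasingEdge : Fin n × Fin n → Set
  IncreasingEdge (x , y) = x <ᶠ y × Adj x y

  increasing? : Decidable IncreasingEdge
  increasing? (x , y) = (x <?ᶠ y) ×-dec adj? x y

  ∈edges⇒adj : ∀ {x y} → (x , y) ∈ˡ edges → Adj x y
  ∈edges⇒adj e∈ = proj₂ (proj₂ (∈-filter⁻ increasing? {xs = cartesianProduct (allFin n) (allFin n)} e∈))

  adj⇒≢ : ∀ {x y} → Adj x y → x ≢ y
  adj⇒≢ xy x≡y = adj-irrefl x≡y xy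

  edge-listed : ∀ {x y} → Adj x y → ∃ λ e → e ∈ˡ edges
  edge-listed {x} {y} xy with <-cmp x y
  ... | tri< x<y _ _ = _ , ∈-filter⁺ increasing? (∈-cartesianProduct⁺ (∈-allFin x) (∈-allFin y)) (x<y , xy)
  ... | tri≈ _ x≡y _ = contradiction xy (adj-irrefl x≡y)
  ... | tri> _ _ y<x =
    _ , ∈-filter⁺ increasing? (∈-cartesianProduct⁺ (∈-allFin y) (∈-allFin x)) (y<x , adj-sym xy)

  weightedSum-cong : ∀ {f g} → (∀ {x y} → Adj x y → f x y ≈ g x y) → weightedSum f ≈ weightedSum g
  weightedSum-cong f≈g = ∑-cong edges (*-congˡ ∘ f≈g ∘ ∈edges⇒adj)

  module _ (T : Hierarchy n) where

    1≤Δ : ∀ {S} → S ∈ˡ 𝓘 T → 1 ≤ⁿ Δ S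
    1≤Δ {l ∣ r} S∈ =
      let x , x∈ = cluster-nonempty l
          y , y∈ = cluster-nonempty r
      in  1≤diam (x∈p∪q⁺ (inj₁ x∈)) (x∈p∪q⁺ (inj₂ y∈))
            λ x≡y → All.lookup (disjointChildren T) S∈ x∈ (≡.subst (_∈ cluster r) (≡.sym x≡y) y∈)

    1≤diamC : ∀ {x y} → x ≢ y → 1 ≤ⁿ diam (C T x y)
    1≤diamC {x} {y} x≢y =
      let x∈ , y∈ = ∈-lca (Hierarchy.tree T) (∈-root T x) (∈-root T y)
      in  1≤diam x∈ y∈ x≢y

    -- Replaces g (C T x y) by a sum over all internal nodes that does not
    -- mention the lowest common ancestor, so that the sums over edges and over
    -- nodes can be exchanged; what each node collects is its cut weight b S.
    weightedSum-C : (g : Subset n → Carrier) →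
                    weightedSum (λ x y → g (C T x y)) ≈ ∑ (𝓘 T) (λ S → b S * g (clusterᴵ S))
    weightedSum-C g = begin
      ∑ edges (λ (x , y) → weight x y * g (C T x y))
        ≈⟨ weightedSum-cong (λ {x} {y} xy → separatingSum-lca g (Hierarchy.tree T) (disjointChildren T)
             (adj⇒≢ xy) (∈-root T x) (∈-root T y)) ⟨
      ∑ edges (λ (x , y) → weight x y * ∑ (𝓘 T) (λ S → [ separates? S (x , y) ]· g (clusterᴵ S)))
        ≈⟨ ∑-cong edges (λ _ → *-distribˡ-∑ (𝓘 T) _ _) ⟩
      ∑ edges (λ (x , y) → ∑ (𝓘 T) (λ S → weight x y * ([ separates? S (x , y) ]· g (clusterᴵ S))))
        ≈⟨ ∑-swap edges (𝓘 T) _ ⟩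
      ∑ (𝓘 T) (λ S → ∑ edges (λ (x , y) → weight x y * ([ separates? S (x , y) ]· g (clusterᴵ S))))
        ≈⟨ ∑-cong (𝓘 T) (λ {S} _ → perNode S) ⟩
      ∑ (𝓘 T) (λ S → b S * g (clusterᴵ S)) ∎
      where
      open SetoidReasoning setoid

      perNode : ∀ S → ∑ edges (λ (x , y) → weight x y * ([ separates? S (x , y) ]· g (clusterᴵ S)))
                      ≈ b S * g (clusterᴵ S)
      perNode S = begin
        ∑ edges (λ (x , y) → weight x y * ([ separates? S (x , y) ]· g (clusterᴵ S)))
          ≈⟨ ∑-cong edges (λ {e} _ → *-[]· (separates? S e) _ _) ⟩
        ∑ edges (λ (x , y) → [ separates? S (x , y) ]· (weight x y * g (clusterᴵ S)))
          ≈⟨ ∑-filter (separates? S) edges _ ⟨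
        ∑ (filter (separates? S) edges) (λ (x , y) → weight x y * g (clusterᴵ S))
          ≈⟨ *-distribʳ-∑ (filter (separates? S) edges) _ _ ⟨
        b S * g (clusterᴵ S) ∎

    cost⁻/F≈𝔼ρ : cost⁻ T / F T ≈ 𝔼 (𝓘 T) (μ T) ρ
    cost⁻/F≈𝔼ρ = begin
      cost⁻ T / F T
        ≈⟨ *-congʳ (weightedSum-C (λ S → fromℕ (∣ S ∣ ∸ 1))) ⟩
      ∑ (𝓘 T) (λ S → b S * fromℕ (∣ clusterᴵ S ∣ ∸ 1)) * F T ⁻¹
        ≈⟨ *-distribʳ-∑ (𝓘 T) _ _ ⟩
      ∑ (𝓘 T) (λ S → b S * fromℕ (∣ clusterᴵ S ∣ ∸ 1) * F T ⁻¹)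
        ≈⟨ ∑-cong (𝓘 T) (λ {S} S∈ → *-congʳ (perNode S (1≤Δ S∈))) ⟩
      ∑ (𝓘 T) (λ S → a S * ρ S * F T ⁻¹)
        ≈⟨ ∑-cong (𝓘 T) (λ {S} _ → xy∙z≈xz∙y (a S) (ρ S) (F T ⁻¹)) ⟩
      ∑ (𝓘 T) (λ S → μ T S * ρ S) ∎
      where
      open SetoidReasoning setoid
      open CommutativeSemigroupProperties *-commutativeSemigroup using (xy∙z≈xz∙y; xy∙z≈y∙xz)

      perNode : ∀ S → 1 ≤ⁿ Δ S → b S * fromℕ (∣ clusterᴵ S ∣ ∸ 1) ≈ a S * ρ S
      perNode S 1≤Δ = begin
        b S * fromℕ (∣ clusterᴵ S ∣ ∸ 1)
          ≈⟨ *-congˡ (*-cancel-inverse _ (1≤x⇒x≉0 (1≤fromℕ 1≤Δ))) ⟨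
        b S * (fromℕ (Δ S) * ρ S)
          ≈⟨ xy∙z≈y∙xz (fromℕ (Δ S)) (b S) (ρ S) ⟨
        a S * ρ S ∎

    -- The summand of a single edge is already at least its weight, because its
    -- cluster has diameter at least 1.
    F-pos : 2 ≤ⁿ n → 0# < F T
    F-pos 2≤n = ≤-trans 0≤w w≤F , λ 0≈F → w≉0 (antisym 0≤w (≤-trans w≤F (≤-reflexive (sym 0≈F))))
      where
      edge = edge-listed (proj₂ (proj₂ (connected⇒related 2≤n connected)))
      x = proj₁ (proj₁ edge)
      y = proj₂ (proj₁ edge)
      xy = ∈edges⇒adj (proj₂ edge)

      0≤w = proj₁ (weight-pos xy)
      w≉0 = proj₂ (weight-pos xy)

      open PartialOrderReasoning poset

      w≤F : weight x y ≤ F T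
      w≤F = begin
        weight x y
          ≈⟨ *-identityˡ _ ⟨
        1# * weight x y
          ≤⟨ *-monoˡ-≤ 0≤w (1≤fromℕ (1≤diamC (adj⇒≢ xy))) ⟩
        fromℕ (diam (C T x y)) * weight x y
          ≈⟨ *-comm _ _ ⟩
        weight x y * fromℕ (diam (C T x y))
          ≤⟨ term≤∑ {xs = edges}
               (λ e∈ → *-nonNeg (proj₁ (weight-pos (∈edges⇒adj e∈))) (0≤fromℕ (diam _))) (proj₂ edge) ⟩
        F T ∎

    d≤h : IsConnected T → ∀ x y → d x y ≤ⁿ h T x y
    d≤h conn x y = if-elim (d x y ≤ⁿ_) (x ≟ᶠ y)
      (λ { ≡.refl → d≤walk (nil {x = x}) })
      (λ _ → let x∈ , y∈ = ∈-lca tree (∈-root T x) (∈-root T y)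
             in  d≤∣S∣∸1 (All.lookup conn (lca∈clusters tree x y)) x∈ y∈)
      where open Hierarchy T

    -- The two costs agree edge by edge because an edge joins distinct vertices.
    h-cost≈cost⁻ : weightedSum (λ x y → fromℕ (h T x y)) ≈ cost⁻ T
    h-cost≈cost⁻ = weightedSum-cong λ {x} {y} xy →
      if-elim (λ k → fromℕ k ≈ fromℕ (∣ C T x y ∣ ∸ 1)) (x ≟ᶠ y)
        (λ x≡y → contradiction xy (adj-irrefl x≡y)) (λ _ → refl)

    OPTcard≤cost⁻ : IsConnected T → ∀ {m} → IsOPTcard m → m ≤ cost⁻ T
    OPTcard≤cost⁻ conn (_ , m≤) = ≤-trans (m≤ T (d≤h conn)) (≤-reflexive h-cost≈cost⁻)

lemma17 : ∀ {c ℓ₁ ℓ₂} (ℝ : Reals c ℓ₁ ℓ₂) (n : ℕ) → 2 ≤ⁿ n →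
    (G : ConnectedWeightedGraph ℝ n) →
    let open Reals ℝ
        open GraphQuantities G
    in
    (∀ T → IsConnected T →
       (cost⁻ T / F T ≈ ∑ (𝓘 T) (λ S → μ T S * ρ S)) ×
       (∑ (𝓘 T) (λ S → μ T S * ρ S) ≈ 𝔼 (𝓘 T) (μ T) ρ)) ×
    (∀ T⋆ → IsConnected T⋆ →
       ∀ OPTfree OPTcard → IsOPTfree OPTfree → IsOPTcard OPTcard →
       F T⋆ ≈ OPTfree →
       OPTcard / OPTfree ≤ 𝔼 (𝓘 T⋆) (μ T⋆) ρ)
lemma17 ℝ n 2≤n G =
  (λ T _ → cost⁻/F≈𝔼ρ T , refl) ,
  λ T⋆ conn OPTfree OPTcard _ isCard F≈OPT → begin
    OPTcard / OPTfree    ≈⟨ *-congˡ (⁻¹-cong F≈OPT) ⟨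
    OPTcard / F T⋆       ≤⟨ *-monoˡ-≤ (0<x⇒0≤x⁻¹ (F-pos T⋆ 2≤n)) (OPTcard≤cost⁻ T⋆ conn isCard) ⟩
    cost⁻ T⋆ / F T⋆      ≈⟨ cost⁻/F≈𝔼ρ T⋆ ⟩
    𝔼 (𝓘 T⋆) (μ T⋆) ρ    ∎
  where
  open Reals ℝ
  open GraphQuantities G
  open OrderedField ℝ
  open Graph G
  open PartialOrderReasoning poset
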